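{- Let $q\ge 41$ be an odd integer. Then the achromatic number of the Cartesian product $K_6\square K_q$ equals $2q+3$.
   Context: For a finite simple graph $G$ and a finite colour set $C$, a vertex colouring $f:V(G)\to C$ is complete if for any two distinct colours $c_1,c_2\in C$ there is an edge $v_1v_2\in E(G)$ with $f(v_i)=c_i$, $i=1,2$. The achromatic number of $G$ is the maximum number of colours in a proper complete vertex colouring of $G$. The Cartesian product $G_1\square G_2$ has vertex set $V(G_1)\times V(G_2)$, with $(u_1,u_2)$ adjacent to $(w_1,w_2)$ iff either $u_1w_1\in E(G_1)$ and $u_2=w_2$, or $u_2w_2\in E(G_2)$ and $u_1=w_1$. -}

module Defs where

open import Level using (0ℓ)
open import Data.Nat using (ℕ; _≤_; _*_)
open import Data.Fin using (Fin)
open import Data.Fin.Properties using (_≟_; *↔×)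
open import Data.Product using (Σ; ∃-syntax; _×_; _,_)
open import Data.Product.Function.NonDependent.Propositional using (_×-↔_)
open import Data.Sum using (_⊎_; inj₁; inj₂)
open import Function.Base using (_∘_)
open import Function.Bundles using (_↔_)
open import Function.Construct.Composition using (_↔-∘_)
open import Function.Construct.Identity using (↔-id)
open import Function.Construct.Symmetry using (↔-sym)
open import Function.Properties.Inverse using (↔⇒↣)
open import Relation.Binary.Core using (Rel)
open import Relation.Binary.Definitions using (Decidable; DecidableEquality; Symmetric; Irreflexive)
open import Relation.Binary.PropositionalEquality using (_≡_; _≢_; refl; sym; ≢-sym)
open import Relation.Nullary.Decidable using (¬?; _×-dec_; _⊎-dec_; via-injection)

-- `finite` also makes equality of vertices decidable; adjacency is required
-- to be decidable separately.
record FiniteSimpleGraph : Set₁ where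
  field
    Vertex : Set
    order  : ℕ
    finite : Vertex ↔ Fin order
    Adj    : Rel Vertex 0ℓ
    adj?   : Decidable Adj
    symm   : Symmetric Adj
    irrefl : Irreflexive _≡_ Adj

  infix 4 _≟ⱽ_
  _≟ⱽ_ : DecidableEquality Vertex
  _≟ⱽ_ = via-injection (↔⇒↣ finite) _≟_

open FiniteSimpleGraph using (Vertex)

K : ℕ → FiniteSimpleGraph
K n = record
  { Vertex = Fin n
  ; order  = n
  ; finite = ↔-id (Fin n)
  ; Adj    = _≢_
  ; adj?   = λ u v → ¬? (u ≟ v)
  ; symm   = ≢-sym
  ; irrefl = λ u≡v u≢v → u≢v u≡v
  }

infixr 7 _□_
_□_ : FiniteSimpleGraph → FiniteSimpleGraph → FiniteSimpleGraph
G₁ □ G₂ = record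
  { Vertex = G₁.Vertex × G₂.Vertex
  ; order  = G₁.order * G₂.order
  ; finite = ↔-sym *↔× ↔-∘ (G₁.finite ×-↔ G₂.finite)
  ; Adj    = λ (u₁ , u₂) (w₁ , w₂) → (G₁.Adj u₁ w₁ × u₂ ≡ w₂) ⊎ (G₂.Adj u₂ w₂ × u₁ ≡ w₁)
  ; adj?   = λ (u₁ , u₂) (w₁ , w₂) →
               (G₁.adj? u₁ w₁ ×-dec u₂ G₂.≟ⱽ w₂) ⊎-dec (G₂.adj? u₂ w₂ ×-dec u₁ G₁.≟ⱽ w₁)
  ; symm   = λ where
               (inj₁ (a , e)) → inj₁ (G₁.symm a , sym e)
               (inj₂ (a , e)) → inj₂ (G₂.symm a , sym e)
  ; irrefl = λ where
               refl (inj₁ (a , _)) → G₁.irrefl refl a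
               refl (inj₂ (a , _)) → G₂.irrefl refl a
  }
  where
  module G₁ = FiniteSimpleGraph G₁
  module G₂ = FiniteSimpleGraph G₂

module _ (G : FiniteSimpleGraph) {C : Set} where
  open FiniteSimpleGraph G using (Adj)

  Proper : (Vertex G → C) → Set
  Proper f = ∀ {u v} → Adj u v → f u ≢ f v

  Complete : (Vertex G → C) → Set
  Complete f = ∀ {c₁ c₂} → c₁ ≢ c₂ → ∃[ v₁ ] ∃[ v₂ ] Adj v₁ v₂ × f v₁ ≡ c₁ × f v₂ ≡ c₂

-- A colour set with k elements is taken to be Fin k.  Surjectivity is not
-- demanded: for k ≥ 2 a complete colouring uses every colour.
HasProperCompleteColouring : FiniteSimpleGraph → ℕ → Set
HasProperCompleteColouring G k = Σ (Vertex G → Fin k) λ f → Proper G f × Complete G f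

-- The achromatic number as a (single-valued) relation: k is the maximum.
IsAchromaticNumber : FiniteSimpleGraph → ℕ → Set
IsAchromaticNumber G k =
  HasProperCompleteColouring G k × (∀ m → HasProperCompleteColouring G m → m ≤ k)

{-# OPTIONS --safe #-}
-- A proper complete colouring of K₆ □ K_q enters the upper bound only through
-- the sets R(c) ⊆ {0,…,5} of rows met by the colours c.  Each row meets at most
-- q colours, and a colour c' with R(c') ∩ R(c) = ∅ shares a column with c, so
-- at most |R(c)| (6 − |R(c)|) colours have row set disjoint from R(c).  With at
-- least 2q + 4 colours and q ≥ 41 this integer program forces every two-element
-- row set that occurs to avoid every other such set, and hence, up to
-- relabelling rows, exactly 01, 23 and 45 to occur.  All 3-colours are then
-- transversals of these pairs.  Complementary transversals may both occur only
-- if each has at most 9 colours, so in the end one of the two parity classes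
-- of transversals is empty; the row equations then give q = 4 + 2x with x the
-- size of a remaining class, which is impossible for odd q.
--
-- For the lower bound take three columns carrying nine 2-colours with row sets
-- 01, 23, 45 and q − 3 columns carrying four classes of (q − 3)/2 3-colours
-- with row sets 024, 035, 125, 134.
module Submission where

open import Defs
import Data.Bool.Properties as Bool
import Data.List.Relation.Unary.All.Properties as All
open import Data.Bool.Base using (Bool; true; false; not; _∧_; _∨_; if_then_else_)
open import Data.Bool.ListAction using (any)
open import Data.Empty using (⊥-elim) renaming (⊥ to Empty)
open import Data.Fin.Base using (Fin; zero; suc; fromℕ; inject₁)
open import Data.Fin.Patterns
open import Data.Fin.Permutation using (Permutation′; transpose; _∘ₚ_; _⟨$⟩ʳ_; _⟨$⟩ˡ_; inverseˡ; inverseʳ; id)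
open import Data.Fin.Properties using (_≟_; all?; any?; suc-injective; *↔×; +↔⊎)
open import Data.Fin.Relation.Unary.Top using (view; ‵fromℕ; ‵inject₁; view-fromℕ; view-inject₁)
open import Data.Fin.Subset using (Subset; ⊥; ⁅_⁆; _∪_)
open import Data.List.Base using (List; []; _∷_; _++_; map; allFin)
open import Data.List.Membership.Propositional using (_∈_)
open import Data.List.Relation.Unary.All as All using (All; []; _∷_)
open import Data.List.Relation.Unary.Any using (here; there)
open import Data.Nat using (ℕ; zero; suc; _+_; _*_; _∸_; _≤_; _<_; _≤ᵇ_; _<ᵇ_; parity; z≤n; s≤s)
open import Data.Nat.Properties hiding (_≟_; suc-injective)
open import Data.Nat.Tactic.RingSolver using (solve-∀)
open import Data.Parity.Base using (1ℙ)
open import Data.Product using (∃-syntax; _×_; _,_; proj₁; proj₂)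
open import Data.Product.Function.NonDependent.Propositional using (_×-↔_)
open import Data.Product.Properties using (,-injective)
open import Data.Sum using (_⊎_; inj₁; inj₂)
open import Data.Sum.Function.Propositional using (_⊎-↔_)
open import Data.Sum.Properties using (inj₁-injective; inj₂-injective)
open import Data.Vec.Base as Vec using (Vec; []; _∷_; lookup; tabulate)
open import Data.Vec.Properties as Vec using (lookup∘tabulate; tabulate-cong)
open import Function.Base using (_∘_; case_of_)
open import Function.Bundles using (Equivalence; Inverse; _↔_)
open import Function.Construct.Composition using (_↔-∘_)
open import Function.Construct.Identity using (↔-id)
open import Function.Construct.Symmetry using (↔-sym)
open import Relation.Binary.PropositionalEquality
open import Relation.Nullary.Decidable using (Dec; yes; no; does; from-yes; dec-true; dec-false; _×-dec_; _→-dec_)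
open import Relation.Nullary.Negation using (¬_; contradiction)

open import Algebra.Properties.Semiring.Sum +-*-semiring
  using (sum; sum-syntax; sum-cong-≗; ∑-comm; ∑-distrib-+; *-distribˡ-sum; *-distribʳ-sum; sum-replicate-zero)

-- Finite sums and counting

private
  variable
    m n : ℕ

𝟙 : Bool → ℕ
𝟙 b = if b then 1 else 0

sum-mono : {u v : Fin n → ℕ} → (∀ i → u i ≤ v i) → sum u ≤ sum v
sum-mono {zero}  u≤v = z≤n
sum-mono {suc n} u≤v = +-mono-≤ (u≤v zero) (sum-mono (u≤v ∘ suc))

term≤sum : (u : Fin n → ℕ) (i : Fin n) → u i ≤ sum u
term≤sum u zero    = m≤m+n _ _
term≤sum u (suc i) = ≤-trans (term≤sum (u ∘ suc) i) (m≤n+m _ _)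

sum-const : ∀ n k → ∑[ i < n ] k ≡ n * k
sum-const zero    k = refl
sum-const (suc n) k = cong (k +_) (sum-const n k)

count-equal : (i : Fin n) → ∑[ j < n ] 𝟙 (does (i ≟ j)) ≡ 1
count-equal {suc n} zero = cong suc (sum-replicate-zero n)
count-equal (suc i) = count-equal i

count-unique : (b : Fin n → Bool) → (∀ {i j} → b i ≡ true → b j ≡ true → i ≡ j) → (∑[ i < n ] 𝟙 (b i)) ≤ 1
count-unique {zero}  b unique = z≤n
count-unique {suc n} b unique with b zero in b₀
... | false = count-unique (b ∘ suc) (λ p q → suc-injective (unique p q))
... | true  = s≤s (≤-reflexive (trans (sum-cong-≗ rest) (sum-replicate-zero n)))
  where
  rest : ∀ i → 𝟙 (b (suc i)) ≡ 0
  rest i with b (suc i) in bᵢ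
  ... | false = refl
  ... | true  = case unique b₀ bᵢ of λ ()

-- Row sets and their relabelling

RowSet : Set
RowSet = Subset 6

disjoint : Vec Bool n → Vec Bool n → Bool
disjoint []      []      = true
disjoint (a ∷ S) (b ∷ T) = not (a ∧ b) ∧ disjoint S T

disjoint⇒∉ : (S T : Vec Bool n) → disjoint S T ≡ true → ∀ i → lookup S i ≡ true → lookup T i ≡ false
disjoint⇒∉ (true ∷ S) (false ∷ T) d  zero    s = refl
disjoint⇒∉ (true ∷ S) (false ∷ T) d  (suc i) s = disjoint⇒∉ S T d i s
disjoint⇒∉ (false ∷ S) (b ∷ T)    d  (suc i) s = disjoint⇒∉ S T d i s

equal : RowSet → RowSet → Bool
equal S T = does (Vec.≡-dec Bool._≟_ S T)

-- The number of cells outside the rows in S but in a column of a given colour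
-- with row set S.
capacity : RowSet → ℕ
capacity S = (∑[ i < 6 ] 𝟙 (lookup S i)) * (∑[ i < 6 ] 𝟙 (not (lookup S i)))

-- This is the preimage of `S` under `π`, to match `relabel`, which composes a colouring with `π` on
-- the rows.
permute : Permutation′ 6 → RowSet → RowSet
permute π S = tabulate (λ i → lookup S (π ⟨$⟩ʳ i))

-- Row and disjointness inequalities for a colouring

Colouring : ℕ → ℕ → Set
Colouring q m = HasProperCompleteColouring (K 6 □ K q) m

module Profile (q m : ℕ) (χ : Colouring q m) where
  f = proj₁ χ

  meets : Fin m → Fin 6 → Bool
  meets c i = does (any? (λ j → f (i , j) ≟ c))

  rowSet : Fin m → RowSet
  rowSet c = tabulate (meets c)

  total : (RowSet → ℕ) → ℕ
  total w = ∑[ c < m ] w (rowSet c)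

  Occupied : RowSet → Set
  Occupied S = ∃[ c ] rowSet c ≡ S

  occupied? : ∀ S → Dec (Occupied S)
  occupied? S = any? (λ c → Vec.≡-dec Bool._≟_ (rowSet c) S)

  present : ∀ {i j c} → f (i , j) ≡ c → lookup (rowSet c) i ≡ true
  present {i} {j} {c} e = trans (lookup∘tabulate (meets c) i) (dec-true (any? (λ j → f (i , j) ≟ c)) (j , e))

  hits : Fin m → Fin 6 → ℕ
  hits c i = ∑[ j < q ] 𝟙 (does (f (i , j) ≟ c))

  𝟙-present≤hits : ∀ c i → 𝟙 (lookup (rowSet c) i) ≤ hits c i
  𝟙-present≤hits c i rewrite lookup∘tabulate (meets c) i with any? (λ j → f (i , j) ≟ c)
  ... | no _ = z≤n
  ... | yes (j , e) = ≤-trans (≤-reflexive (cong 𝟙 (sym (dec-true (f (i , j) ≟ c) e)))) (term≤sum (λ j → 𝟙 (does (f (i , j) ≟ c))) j)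

  does⇒ : ∀ {i j : Fin m} → does (i ≟ j) ≡ true → i ≡ j
  does⇒ {i} {j} e with i ≟ j
  ... | yes p = p

  -- The cells of a row are pairwise adjacent, so properness allows a colour at most once in it.
  hits≤𝟙-present : ∀ c i → hits c i ≤ 𝟙 (lookup (rowSet c) i)
  hits≤𝟙-present c i rewrite lookup∘tabulate (meets c) i with any? (λ j → f (i , j) ≟ c)
  ... | no ∄j = ≤-reflexive (trans (sum-cong-≗ (λ j → cong 𝟙 (dec-false (f (i , j) ≟ c) (λ e → ∄j (j , e))))) (sum-replicate-zero q))
  ... | yes _ = count-unique _ unique
    where
    unique : ∀ {j j′} → does (f (i , j) ≟ c) ≡ true → does (f (i , j′) ≟ c) ≡ true → j ≡ j′
    unique {j} {j′} p p′ with j ≟ j′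
    ... | yes j≡j′ = j≡j′
    ... | no  j≢j′ = contradiction (trans (does⇒ p) (sym (does⇒ p′))) (proj₁ (proj₂ χ) (inj₂ (j≢j′ , refl)))

  -- Double counting of the q cells of row `i`, each of which has exactly one colour.
  row-total : ∀ i → total (λ S → 𝟙 (lookup S i)) ≤ q
  row-total i = begin
    (∑[ c < m ] 𝟙 (lookup (rowSet c) i))              ≤⟨ sum-mono (λ c → 𝟙-present≤hits c i) ⟩
    (∑[ c < m ] ∑[ j < q ] 𝟙 (does (f (i , j) ≟ c)))  ≡⟨ ∑-comm (λ c j → 𝟙 (does (f (i , j) ≟ c))) ⟩
    (∑[ j < q ] ∑[ c < m ] 𝟙 (does (f (i , j) ≟ c)))  ≡⟨ sum-cong-≗ (λ j → count-equal (f (i , j))) ⟩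
    (∑[ j < q ] 1)                                    ≡⟨ sum-const q 1 ⟩
    q * 1                                             ≡⟨ *-identityʳ q ⟩
    q                                                 ∎
    where open ≤-Reasoning

  module _ (c : Fin m) where
    private
      S = rowSet c

      weight : Fin q → Fin 6 → ℕ
      weight j i = 𝟙 (does (f (i , j) ≟ c))

      outside : Fin 6 → ℕ
      outside i = 𝟙 (not (lookup S i))

      -- Nonzero only if column `j` contains `c`, row `i′` lies outside `S` and the cell where they
      -- cross has colour `c′`. The product form lets the sums be exchanged and factored.
      cells : Fin q → Fin 6 → Fin m → ℕ
      cells j i′ c′ = (sum (weight j) * outside i′) * 𝟙 (does (f (i′ , j) ≟ c′))

    disjoint≤cells : ∀ i → lookup S i ≡ true → ∀ c′ → 𝟙 (disjoint S (rowSet c′)) ≤ ∑[ j < q ] ∑[ i′ < 6 ] cells j i′ c′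
    disjoint≤cells i₀ i₀∈S c′ with disjoint S (rowSet c′) in d
    ... | false = z≤n
    ... | true with c ≟ c′
    -- `S` contains `i₀`, so it is not disjoint from itself.
    ...   | yes refl = case trans (sym i₀∈S) (disjoint⇒∉ S S d i₀ i₀∈S) of λ ()
    ...   | no c≢c′ with proj₂ (proj₂ χ) c≢c′
    -- An edge along a row would put that row into both row sets, so the edge given by completeness
    -- runs along a column.
    ...     | (i , j) , (i′ , _) , inj₂ (_ , refl) , e , e′ =
              case trans (sym (present e′)) (disjoint⇒∉ S (rowSet c′) d i (present e)) of λ ()
    ...     | (i , j) , (i′ , _) , inj₁ (_ , refl) , e , e′ = begin
              1                                    ≤⟨ *-mono-≤ (*-mono-≤ column outsideRow) cell ⟩
              cells j i′ c′                        ≤⟨ term≤sum (λ i → cells j i c′) i′ ⟩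
              (∑[ i < 6 ] cells j i c′)            ≤⟨ term≤sum (λ j → ∑[ i < 6 ] cells j i c′) j ⟩
              (∑[ j < q ] ∑[ i < 6 ] cells j i c′) ∎
      where
      open ≤-Reasoning

      column : 1 ≤ sum (weight j)
      column = ≤-trans (≤-reflexive (cong 𝟙 (sym (dec-true (f (i , j) ≟ c) e)))) (term≤sum (weight j) i)

      outsideRow : 1 ≤ outside i′
      outsideRow with lookup S i′ in s
      ... | false = ≤-refl
      ... | true  = case trans (sym (present e′)) (disjoint⇒∉ S (rowSet c′) d i′ s) of λ ()

      cell : 1 ≤ 𝟙 (does (f (i′ , j) ≟ c′))
      cell = ≤-reflexive (cong 𝟙 (sym (dec-true (f (i′ , j) ≟ c′) e′)))

    cells-total : ∀ j → (∑[ c′ < m ] ∑[ i′ < 6 ] cells j i′ c′) ≡ sum (weight j) * sum outside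
    cells-total j = begin
      (∑[ c′ < m ] ∑[ i′ < 6 ] cells j i′ c′)  ≡⟨ ∑-comm (λ c′ i′ → cells j i′ c′) ⟩
      (∑[ i′ < 6 ] ∑[ c′ < m ] cells j i′ c′)  ≡⟨ sum-cong-≗ (λ i′ → sym (*-distribˡ-sum (sum (weight j) * outside i′) (λ c′ → 𝟙 (does (f (i′ , j) ≟ c′))))) ⟩
      (∑[ i′ < 6 ] ((sum (weight j) * outside i′) * (∑[ c′ < m ] 𝟙 (does (f (i′ , j) ≟ c′)))))
                                               ≡⟨ sum-cong-≗ (λ i′ → trans (cong ((sum (weight j) * outside i′) *_) (count-equal (f (i′ , j)))) (*-identityʳ (sum (weight j) * outside i′))) ⟩
      (∑[ i′ < 6 ] (sum (weight j) * outside i′)) ≡⟨ *-distribˡ-sum (sum (weight j)) outside ⟨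
      sum (weight j) * sum outside             ∎
      where open ≡-Reasoning

    -- By properness `c` has at most |S| cells, and the column of each offers 6 - |S| cells outside
    -- the rows in `S`.
    disjoint-total : ∀ i → lookup S i ≡ true → total (λ T → 𝟙 (disjoint S T)) ≤ capacity S
    disjoint-total i i∈S = begin
      total (λ T → 𝟙 (disjoint S T))                         ≤⟨ sum-mono (disjoint≤cells i i∈S) ⟩
      (∑[ c′ < m ] ∑[ j < q ] ∑[ i′ < 6 ] cells j i′ c′)     ≡⟨ ∑-comm (λ c′ j → ∑[ i′ < 6 ] cells j i′ c′) ⟩
      (∑[ j < q ] ∑[ c′ < m ] ∑[ i′ < 6 ] cells j i′ c′)     ≡⟨ sum-cong-≗ cells-total ⟩
      (∑[ j < q ] (sum (weight j) * sum outside))            ≡⟨ *-distribʳ-sum (sum outside) (λ j → sum (weight j)) ⟨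
      (∑[ j < q ] ∑[ i < 6 ] weight j i) * sum outside       ≡⟨ cong (_* sum outside) (∑-comm weight) ⟩
      (∑[ i < 6 ] hits c i) * sum outside                    ≤⟨ *-monoˡ-≤ (sum outside) (sum-mono (hits≤𝟙-present c)) ⟩
      capacity S                                             ∎
      where open ≤-Reasoning

  module _ (2≤m : 2 ≤ m) where

    -- Colourings are not assumed surjective; completeness for `c` and any other colour supplies a
    -- cell of colour `c`.
    appears : ∀ c → ∃[ i ] lookup (rowSet c) i ≡ true
    appears c with other c 2≤m
      where
      other : ∀ {m} (c : Fin m) → 2 ≤ m → ∃[ c′ ] c ≢ c′
      other zero    (s≤s (s≤s z≤n)) = 1F , λ ()
      other (suc c) (s≤s (s≤s z≤n)) = 0F , λ ()
    ... | c′ , c≢c′ with proj₂ (proj₂ χ) c≢c′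
    ...   | (i , j) , _ , _ , e , _ = i , present e

    ⊥-unoccupied : ¬ Occupied ⊥
    ⊥-unoccupied (c , e) with appears c
    ... | i , i∈c = case trans (sym i∈c) (trans (cong (λ S → lookup S i) e) (Vec.lookup-replicate i false)) of λ ()

    occupied-total : ∀ {S} → Occupied S → total (λ T → 𝟙 (disjoint S T)) ≤ capacity S
    occupied-total (c , refl) = let i , i∈c = appears c in disjoint-total c i i∈c

-- Small row sets and exhaustive comparison over all row sets

pair : Fin 6 → Fin 6 → RowSet
pair i j = ⁅ i ⁆ ∪ ⁅ j ⁆

triple : Fin 6 → Fin 6 → Fin 6 → RowSet
triple i j k = ⁅ i ⁆ ∪ pair j k

≤ᵇ-sound : (m ≤ᵇ n) ≡ true → m ≤ n
≤ᵇ-sound = ≤ᵇ⇒≤ _ _ ∘ Equivalence.from Bool.T-≡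

any-equal : ∀ {S} A → any (equal S) A ≡ true → S ∈ A
any-equal {S} (T ∷ A) e with Vec.≡-dec Bool._≟_ S T
... | yes S≡T = here S≡T
... | no _    = there (any-equal A e)

-- Opaque, as unfolding it on a goal with free variables yields 64 conjuncts.
opaque
  everywhere : ∀ n → (Vec Bool n → Bool) → Bool
  everywhere zero    p = p []
  everywhere (suc n) p = everywhere n (p ∘ (true ∷_)) ∧ everywhere n (p ∘ (false ∷_))

  everywhere-sound : (p : Vec Bool n → Bool) → everywhere n p ≡ true → ∀ S → p S ≡ true
  everywhere-sound p e []          = e
  everywhere-sound p e (true  ∷ S) = everywhere-sound (p ∘ (true ∷_)) (Bool.∧-conicalˡ _ _ e) S
  everywhere-sound p e (false ∷ S) = everywhere-sound (p ∘ (false ∷_)) (Bool.∧-conicalʳ _ _ e) S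

  dominated : List RowSet → (u v : RowSet → ℕ) → Bool
  dominated A u v = everywhere 6 (λ S → any (equal S) A ∨ (u S ≤ᵇ v S))

  dominated-sound : ∀ A u v → dominated A u v ≡ true → ∀ S → S ∈ A ⊎ u S ≤ v S
  dominated-sound A u v e S with any (equal S) A in a | everywhere-sound (λ S → any (equal S) A ∨ (u S ≤ᵇ v S)) e S
  ... | true  | _  = inj₁ (any-equal A a)
  ... | false | e′ = inj₂ (≤ᵇ-sound e′)

-- Certificates for the integer program

rowWeight : Vec ℕ 6 → RowSet → ℕ
rowWeight r S = ∑[ i < 6 ] (lookup r i * 𝟙 (lookup S i))

-- Multipliers are matched with `P` from its head; members of `P` beyond the end of the list get
-- multiplier 0.
disjointWeight equalWeight : List ℕ → List RowSet → RowSet → ℕ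
disjointWeight (a ∷ as) (T ∷ P) S = a * 𝟙 (disjoint T S) + disjointWeight as P S
disjointWeight _        _       S = 0
equalWeight    (b ∷ bs) (T ∷ P) S = b * 𝟙 (equal S T) + equalWeight bs P S
equalWeight    _        _       S = 0

disjointBound equalBound : List ℕ → List RowSet → ℕ
disjointBound (a ∷ as) (T ∷ P) = a * capacity T + disjointBound as P
disjointBound _        _       = 0
equalBound    (b ∷ bs) (T ∷ P) = b + equalBound bs P
equalBound    _        _       = 0

-- A certificate that no colouring with at least 2q + 4 colours has all of the
-- row sets in P and none of those in A.  A leaf farkas adds r i copies of "row
-- i meets at most q colours" and a copies of "at most capacity T colours are
-- disjoint from T" (T ∈ P, a ∈ as), and compares the result with ν copies of
-- "there are at least 2q + 4 colours" and b copies of "T occurs" (T ∈ P,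
-- b ∈ bs).  A leaf even shows that exactly (q − 4)/2 colours have row set X.
-- The multipliers were found by linear programming.  P grows at its head.
data Refutation : Set where
  farkas : (ν : ℕ) (r : Vec ℕ 6) (as bs : List ℕ) → Refutation
  even   : (X : RowSet) (ν : ℕ) (r : Vec ℕ 6) (as : List ℕ) (r′ : Vec ℕ 6) → Refutation
  branch : (S : RowSet) (occupied unoccupied : Refutation) → Refutation

-- Write ρ for the sum of `r`, and D, B for the two bounds. Summed over the m colours, the
-- domination in a `farkas` leaf gives ν m + B ≤ ρ q + D, hence (2ν - ρ) q + 4ν + B ≤ D. The last
-- test denies this at q = 41, and ρ ≤ 2ν extends the denial to all larger q.
check : (P A : List RowSet) → Refutation → Bool
check P A (farkas ν r as bs) =
  dominated A (λ S → ν + equalWeight bs P S) (λ S → rowWeight r S + disjointWeight as P S) ∧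
  ((sum (lookup r) ≤ᵇ 2 * ν) ∧
   (disjointBound as P <ᵇ equalBound bs P + 4 * ν + 41 * (2 * ν ∸ sum (lookup r))))
check P A (even X ν r as r′) =
  (dominated A (λ S → ν) (λ S → rowWeight r S + disjointWeight as P S + 2 * 𝟙 (equal S X)) ∧
   dominated A (λ S → 1 + 2 * 𝟙 (equal S X)) (rowWeight r′)) ∧
  ((suc (sum (lookup r)) ≤ᵇ 2 * ν) ∧ ((disjointBound as P ≤ᵇ 4 * ν + 4) ∧ (sum (lookup r′) ≤ᵇ 3)))
check P A (branch S t u) = check (S ∷ P) A t ∧ check P (S ∷ A) u

-- The certificates themselves

thin : List RowSet
thin = ⊥ ∷ map ⁅_⁆ (allFin 6)

-- Pairs sharing just one row with 01, respectively with 23; those of the second kind that meet row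
-- 0 or 1 are already in `adjacent₀₁`.
adjacent₀₁ adjacent₂₃ : List RowSet
adjacent₀₁ = map (pair 0F) (2F ∷ 3F ∷ 4F ∷ 5F ∷ []) ++ map (pair 1F) (2F ∷ 3F ∷ 4F ∷ 5F ∷ [])
adjacent₂₃ = map (pair 2F) (4F ∷ 5F ∷ []) ++ map (pair 3F) (4F ∷ 5F ∷ [])

pairs₂₃₄₅ pairs : List RowSet
pairs₂₃₄₅ = pair 2F 3F ∷ pair 2F 4F ∷ pair 2F 5F ∷ pair 3F 4F ∷ pair 3F 5F ∷ pair 4F 5F ∷ []
pairs = pair 0F 1F ∷ adjacent₀₁ ++ pairs₂₃₄₅

-- Every colour meets row `i` or is disjoint from it, so there are at most q + 5 colours.
singleton-refutation : Fin 6 → Refutation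
singleton-refutation i = farkas 1 (Vec.map 𝟙 ⁅ i ⁆) (1 ∷ []) []

path-refutation matching-refutation two-couples-refutation couple-refutation pair-refutation : Refutation

-- At most 8 colours are disjoint from 01 and at most 8 from 02; all others meet row 0 or both rows
-- 1 and 2. The branches ask for further pairs through row 0, for 12, and for triples joining row 0
-- to two of the rows 3, 4, 5.
path-refutation =
  branch (pair 0F 3F)
    (branch (pair 0F 4F)
      (branch (pair 0F 5F)
        (farkas 5 (4 ∷ 1 ∷ 1 ∷ 1 ∷ 1 ∷ 1 ∷ []) (1 ∷ 1 ∷ 1 ∷ 1 ∷ 1 ∷ []) [])
        (farkas 4 (3 ∷ 1 ∷ 1 ∷ 1 ∷ 1 ∷ 0 ∷ []) (1 ∷ 1 ∷ 1 ∷ 1 ∷ []) []))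
      (branch (pair 0F 5F)
        (farkas 4 (3 ∷ 1 ∷ 1 ∷ 1 ∷ 0 ∷ 1 ∷ []) (1 ∷ 1 ∷ 1 ∷ 1 ∷ []) [])
        (branch (triple 0F 4F 5F)
          (farkas 7 (5 ∷ 2 ∷ 2 ∷ 2 ∷ 1 ∷ 1 ∷ []) (1 ∷ 2 ∷ 2 ∷ 2 ∷ []) [])
          (farkas 3 (2 ∷ 1 ∷ 1 ∷ 1 ∷ 0 ∷ 0 ∷ []) (1 ∷ 1 ∷ 1 ∷ []) []))))
    (branch (pair 0F 4F)
      (branch (pair 0F 5F)
        (farkas 4 (3 ∷ 1 ∷ 1 ∷ 0 ∷ 1 ∷ 1 ∷ []) (1 ∷ 1 ∷ 1 ∷ 1 ∷ []) [])
        (branch (triple 0F 3F 5F)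
          (farkas 7 (5 ∷ 2 ∷ 2 ∷ 1 ∷ 2 ∷ 1 ∷ []) (1 ∷ 2 ∷ 2 ∷ 2 ∷ []) [])
          (farkas 3 (2 ∷ 1 ∷ 1 ∷ 0 ∷ 1 ∷ 0 ∷ []) (1 ∷ 1 ∷ 1 ∷ []) [])))
      (branch (pair 0F 5F)
        (branch (triple 0F 3F 4F)
          (farkas 7 (5 ∷ 2 ∷ 2 ∷ 1 ∷ 1 ∷ 2 ∷ []) (1 ∷ 2 ∷ 2 ∷ 2 ∷ []) [])
          (farkas 3 (2 ∷ 1 ∷ 1 ∷ 0 ∷ 0 ∷ 1 ∷ []) (1 ∷ 1 ∷ 1 ∷ []) []))
        (branch (pair 1F 2F)
          (farkas 2 (1 ∷ 1 ∷ 1 ∷ 0 ∷ 0 ∷ 0 ∷ []) (1 ∷ 1 ∷ 1 ∷ []) [])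
          (branch (triple 0F 3F 4F)
            (branch (triple 0F 3F 5F)
              (branch (triple 0F 4F 5F)
                (farkas 6 (4 ∷ 2 ∷ 2 ∷ 1 ∷ 1 ∷ 1 ∷ []) (1 ∷ 1 ∷ 1 ∷ 2 ∷ 2 ∷ []) [])
                (farkas 8 (5 ∷ 3 ∷ 3 ∷ 2 ∷ 1 ∷ 1 ∷ []) (1 ∷ 1 ∷ 3 ∷ 3 ∷ []) []))
              (branch (triple 0F 4F 5F)
                (farkas 8 (5 ∷ 3 ∷ 3 ∷ 1 ∷ 2 ∷ 1 ∷ []) (1 ∷ 1 ∷ 3 ∷ 3 ∷ []) [])
                (farkas 5 (3 ∷ 2 ∷ 2 ∷ 1 ∷ 1 ∷ 0 ∷ []) (1 ∷ 2 ∷ 2 ∷ []) [])))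
            (branch (triple 0F 3F 5F)
              (branch (triple 0F 4F 5F)
                (farkas 8 (5 ∷ 3 ∷ 3 ∷ 1 ∷ 1 ∷ 2 ∷ []) (1 ∷ 1 ∷ 3 ∷ 3 ∷ []) [])
                (farkas 5 (3 ∷ 2 ∷ 2 ∷ 1 ∷ 0 ∷ 1 ∷ []) (1 ∷ 2 ∷ 2 ∷ []) []))
              (branch (triple 0F 4F 5F)
                (farkas 5 (3 ∷ 2 ∷ 2 ∷ 0 ∷ 1 ∷ 1 ∷ []) (1 ∷ 2 ∷ 2 ∷ []) [])
                (farkas 7 (4 ∷ 3 ∷ 3 ∷ 1 ∷ 1 ∷ 1 ∷ []) (3 ∷ 3 ∷ []) [])))))))

-- The pairs that occur are now exactly 01, 23 and 45. The branches run through the transversals,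
-- first the parity class 135, 124, 034, 025, then its complements. Only when one class is entirely
-- absent is an `even` leaf called for.
matching-refutation =
  branch (triple 1F 3F 5F)
    (branch (triple 1F 2F 4F)
      (branch (triple 0F 3F 4F)
        (branch (triple 0F 2F 5F)
          (branch (triple 0F 2F 4F)
            -- The `farkas` leaf reached if this triple occurs amounts to 52 < 12 + q, which is true
            -- exactly from q = 41 on.
            (branch (triple 0F 3F 5F)
              (farkas 3 (1 ∷ 0 ∷ 1 ∷ 1 ∷ 1 ∷ 1 ∷ []) (1 ∷ 1 ∷ 1 ∷ 1 ∷ 0 ∷ 0 ∷ 1 ∷ 1 ∷ []) [])
              (farkas 5 (2 ∷ 1 ∷ 2 ∷ 1 ∷ 2 ∷ 1 ∷ []) (2 ∷ 1 ∷ 1 ∷ 0 ∷ 0 ∷ 1 ∷ 1 ∷ 1 ∷ []) (1 ∷ [])))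
            (branch (triple 0F 3F 5F)
              (farkas 5 (2 ∷ 1 ∷ 1 ∷ 2 ∷ 1 ∷ 2 ∷ []) (2 ∷ 1 ∷ 1 ∷ 0 ∷ 0 ∷ 1 ∷ 1 ∷ 1 ∷ []) (1 ∷ []))
              (branch (triple 1F 2F 5F)
                (farkas 5 (1 ∷ 2 ∷ 2 ∷ 1 ∷ 1 ∷ 2 ∷ []) (2 ∷ 1 ∷ 0 ∷ 0 ∷ 0 ∷ 1 ∷ 1 ∷ 1 ∷ []) (1 ∷ []))
                (branch (triple 1F 3F 4F)
                  (farkas 5 (1 ∷ 2 ∷ 1 ∷ 2 ∷ 2 ∷ 1 ∷ []) (2 ∷ 0 ∷ 0 ∷ 0 ∷ 0 ∷ 1 ∷ 1 ∷ 1 ∷ []) (1 ∷ []))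
                  (even (triple 1F 3F 5F) 5 (2 ∷ 1 ∷ 2 ∷ 1 ∷ 2 ∷ 1 ∷ []) (0 ∷ 0 ∷ 0 ∷ 0 ∷ 1 ∷ 1 ∷ 1 ∷ []) (0 ∷ 1 ∷ 0 ∷ 1 ∷ 0 ∷ 1 ∷ []))))))
          (farkas 5 (1 ∷ 2 ∷ 1 ∷ 2 ∷ 2 ∷ 1 ∷ []) (1 ∷ 1 ∷ 1 ∷ 1 ∷ 1 ∷ 1 ∷ []) []))
        (branch (triple 0F 2F 5F)
          (farkas 5 (1 ∷ 2 ∷ 2 ∷ 1 ∷ 1 ∷ 2 ∷ []) (1 ∷ 1 ∷ 1 ∷ 1 ∷ 1 ∷ 1 ∷ []) [])
          (farkas 3 (0 ∷ 1 ∷ 1 ∷ 1 ∷ 1 ∷ 1 ∷ []) (1 ∷ 1 ∷ 1 ∷ 1 ∷ []) [])))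
      (branch (triple 0F 3F 4F)
        (branch (triple 0F 2F 5F)
          (farkas 5 (2 ∷ 1 ∷ 1 ∷ 2 ∷ 1 ∷ 2 ∷ []) (1 ∷ 1 ∷ 1 ∷ 1 ∷ 1 ∷ 1 ∷ []) [])
          (farkas 3 (1 ∷ 1 ∷ 0 ∷ 1 ∷ 1 ∷ 1 ∷ []) (1 ∷ 1 ∷ 1 ∷ 0 ∷ 1 ∷ []) []))
        (branch (triple 0F 2F 5F)
          (farkas 3 (1 ∷ 1 ∷ 1 ∷ 1 ∷ 0 ∷ 1 ∷ []) (1 ∷ 1 ∷ 0 ∷ 1 ∷ 1 ∷ []) [])
          (farkas 5 (1 ∷ 2 ∷ 1 ∷ 2 ∷ 1 ∷ 2 ∷ []) (2 ∷ 1 ∷ 1 ∷ 1 ∷ []) (1 ∷ [])))))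
    (branch (triple 1F 2F 4F)
      (branch (triple 0F 3F 4F)
        (branch (triple 0F 2F 5F)
          (farkas 5 (2 ∷ 1 ∷ 2 ∷ 1 ∷ 2 ∷ 1 ∷ []) (1 ∷ 1 ∷ 1 ∷ 1 ∷ 1 ∷ 1 ∷ []) [])
          (farkas 3 (1 ∷ 1 ∷ 1 ∷ 1 ∷ 1 ∷ 0 ∷ []) (1 ∷ 1 ∷ 0 ∷ 1 ∷ 1 ∷ []) []))
        (branch (triple 0F 2F 5F)
          (farkas 3 (1 ∷ 1 ∷ 1 ∷ 0 ∷ 1 ∷ 1 ∷ []) (1 ∷ 1 ∷ 1 ∷ 0 ∷ 1 ∷ []) [])
          (farkas 5 (1 ∷ 2 ∷ 2 ∷ 1 ∷ 2 ∷ 1 ∷ []) (2 ∷ 1 ∷ 1 ∷ 1 ∷ []) (1 ∷ []))))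
      (branch (triple 0F 3F 4F)
        (branch (triple 0F 2F 5F)
          (farkas 3 (1 ∷ 0 ∷ 1 ∷ 1 ∷ 1 ∷ 1 ∷ []) (1 ∷ 1 ∷ 1 ∷ 1 ∷ []) [])
          (farkas 5 (2 ∷ 1 ∷ 1 ∷ 2 ∷ 2 ∷ 1 ∷ []) (2 ∷ 1 ∷ 1 ∷ 1 ∷ []) (1 ∷ [])))
        (branch (triple 0F 2F 5F)
          (farkas 5 (2 ∷ 1 ∷ 2 ∷ 1 ∷ 1 ∷ 2 ∷ []) (2 ∷ 1 ∷ 1 ∷ 1 ∷ []) (1 ∷ []))
          (even (triple 0F 2F 4F) 5 (1 ∷ 2 ∷ 1 ∷ 2 ∷ 1 ∷ 2 ∷ []) (1 ∷ 1 ∷ 1 ∷ []) (1 ∷ 0 ∷ 1 ∷ 0 ∷ 1 ∷ 0 ∷ [])))))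

-- Without 45 the multipliers give 5m ≤ 10q + 16, against 5m ≥ 10q + 20.
two-couples-refutation =
  branch (pair 4F 5F) matching-refutation
    (farkas 5 (2 ∷ 2 ∷ 2 ∷ 2 ∷ 1 ∷ 1 ∷ []) (1 ∷ 1 ∷ []) [])

-- Counting rows 0 and 1 twice, and the at most 8 colours disjoint from 01 once more, gives 4m ≤ 8q
-- + 8, against 4m ≥ 8q + 16.
couple-refutation = farkas 4 (2 ∷ 2 ∷ 1 ∷ 1 ∷ 1 ∷ 1 ∷ []) (1 ∷ []) []

-- All row sets have at least three elements, so 3m ≤ 6q.
pair-refutation = farkas 3 (1 ∷ 1 ∷ 1 ∷ 1 ∷ 1 ∷ 1 ∷ []) [] []

opaque
  unfolding dominated

  singleton-check : ∀ i → check (⁅ i ⁆ ∷ []) (⊥ ∷ []) (singleton-refutation i) ≡ true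
  singleton-check = from-yes (all? λ i → check (⁅ i ⁆ ∷ []) (⊥ ∷ []) (singleton-refutation i) Bool.≟ true)

  path-check : check (pair 0F 2F ∷ pair 0F 1F ∷ []) thin path-refutation ≡ true
  path-check = refl

  two-couples-check : check (pair 2F 3F ∷ pair 0F 1F ∷ []) (thin ++ adjacent₀₁ ++ adjacent₂₃) two-couples-refutation ≡ true
  two-couples-check = refl

  couple-check : check (pair 0F 1F ∷ []) (thin ++ adjacent₀₁ ++ pairs₂₃₄₅) couple-refutation ≡ true
  couple-check = refl

  pair-check : check [] (thin ++ pairs) pair-refutation ≡ true
  pair-check = refl

-- Soundness of the certificates for at least 2q + 4 colours

odd≢4+2* : ∀ x → parity (4 + 2 * x) ≢ 1ℙ
odd≢4+2* zero    ()
odd≢4+2* (suc x) odd rewrite +-suc x (x + 0) = odd≢4+2* x odd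

module Overfull {q m} (41≤q : 41 ≤ q) (odd : parity q ≡ 1ℙ) (2q+4≤m : 2 * q + 4 ≤ m) where

  2≤m : 2 ≤ m
  2≤m = ≤-trans (s≤s (s≤s z≤n)) (≤-trans (m≤n+m 4 (2 * q)) 2q+4≤m)

  module _ (χ : Colouring q m) where
    open Profile q m χ

    All-¬ : List RowSet → Set
    All-¬ = All (¬_ ∘ Occupied)

    total-mono : ∀ {A} → All-¬ A → ∀ u v → dominated A u v ≡ true → total u ≤ total v
    total-mono {A} ¬A u v e = sum-mono pointwise
      where
      pointwise : ∀ c → u (rowSet c) ≤ v (rowSet c)
      pointwise c with dominated-sound A u v e (rowSet c)
      ... | inj₁ c∈A = contradiction (c , refl) (All.lookup ¬A c∈A)
      ... | inj₂ u≤v = u≤v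

    total-scale : ∀ k w → total (λ S → k * w S) ≡ k * total w
    total-scale k w = sym (*-distribˡ-sum k (w ∘ rowSet))

    total-+ : ∀ u v → total (λ S → u S + v S) ≡ total u + total v
    total-+ u v = ∑-distrib-+ (u ∘ rowSet) (v ∘ rowSet)

    rowWeight-total : ∀ r → total (rowWeight r) ≤ sum (lookup r) * q
    rowWeight-total r = begin
      total (rowWeight r)                                        ≡⟨ ∑-comm (λ c i → lookup r i * 𝟙 (lookup (rowSet c) i)) ⟩
      (∑[ i < 6 ] total (λ S → lookup r i * 𝟙 (lookup S i)))     ≡⟨ sum-cong-≗ (λ i → total-scale (lookup r i) (λ S → 𝟙 (lookup S i))) ⟩
      (∑[ i < 6 ] (lookup r i * total (λ S → 𝟙 (lookup S i))))   ≤⟨ sum-mono (λ i → *-monoʳ-≤ (lookup r i) (row-total i)) ⟩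
      (∑[ i < 6 ] (lookup r i * q))                              ≡⟨ *-distribʳ-sum q (lookup r) ⟨
      sum (lookup r) * q                                         ∎
      where open ≤-Reasoning

    disjointWeight-total : ∀ as {P} → All Occupied P → total (disjointWeight as P) ≤ disjointBound as P
    disjointWeight-total []       {[]}    _       = ≤-reflexive (sum-replicate-zero m)
    disjointWeight-total []       {_ ∷ _} _       = ≤-reflexive (sum-replicate-zero m)
    disjointWeight-total (_ ∷ _)  {[]}    _       = ≤-reflexive (sum-replicate-zero m)
    disjointWeight-total (a ∷ as) {T ∷ P} (o ∷ os) = begin
      total (disjointWeight (a ∷ as) (T ∷ P))                        ≡⟨ total-+ (λ S → a * 𝟙 (disjoint T S)) (disjointWeight as P) ⟩
      total (λ S → a * 𝟙 (disjoint T S)) + total (disjointWeight as P) ≡⟨ cong (_+ total (disjointWeight as P)) (total-scale a (λ S → 𝟙 (disjoint T S))) ⟩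
      a * total (λ S → 𝟙 (disjoint T S)) + total (disjointWeight as P) ≤⟨ +-mono-≤ (*-monoʳ-≤ a (occupied-total 2≤m o)) (disjointWeight-total as os) ⟩
      a * capacity T + disjointBound as P                            ∎
      where open ≤-Reasoning

    equal-total : ∀ {T} → Occupied T → 1 ≤ total (λ S → 𝟙 (equal S T))
    equal-total {T} (c , e) = ≤-trans (≤-reflexive (cong 𝟙 (sym (dec-true (Vec.≡-dec Bool._≟_ (rowSet c) T) e))))
                                      (term≤sum (λ c → 𝟙 (equal (rowSet c) T)) c)

    equalWeight-total : ∀ bs {P} → All Occupied P → equalBound bs P ≤ total (equalWeight bs P)
    equalWeight-total []       {[]}    _       = z≤n
    equalWeight-total []       {_ ∷ _} _       = z≤n
    equalWeight-total (_ ∷ _)  {[]}    _       = z≤n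
    equalWeight-total (b ∷ bs) {T ∷ P} (o ∷ os) = begin
      b + equalBound bs P                                             ≡⟨ cong (_+ equalBound bs P) (*-identityʳ b) ⟨
      b * 1 + equalBound bs P                                         ≤⟨ +-mono-≤ (*-monoʳ-≤ b (equal-total o)) (equalWeight-total bs os) ⟩
      b * total (λ S → 𝟙 (equal S T)) + total (equalWeight bs P)      ≡⟨ cong (_+ total (equalWeight bs P)) (total-scale b (λ S → 𝟙 (equal S T))) ⟨
      total (λ S → b * 𝟙 (equal S T)) + total (equalWeight bs P)      ≡⟨ total-+ (λ S → b * 𝟙 (equal S T)) (equalWeight bs P) ⟨
      total (equalWeight (b ∷ bs) (T ∷ P))                            ∎
      where open ≤-Reasoning

    total-const : ∀ k → total (λ S → k) ≡ k * m
    total-const k = trans (sum-const m k) (*-comm m k)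

    farkas-sound : ∀ {P A} ν r as bs → All Occupied P → All-¬ A → check P A (farkas ν r as bs) ≡ true → Empty
    farkas-sound {P} {A} ν r as bs ps ¬A e = <-irrefl refl (begin-strict
        ρ * q + D                          <⟨ +-monoʳ-< (ρ * q) D< ⟩
        ρ * q + (B + 4 * ν + 41 * ε)       ≤⟨ +-monoʳ-≤ (ρ * q) (+-monoʳ-≤ (B + 4 * ν) (*-monoˡ-≤ ε 41≤q)) ⟩
        ρ * q + (B + 4 * ν + q * ε)        ≡⟨ rearrange ρ ε q B ν ⟩
        (ρ + ε) * q + 4 * ν + B            ≡⟨ cong (λ k → k * q + 4 * ν + B) (m+[n∸m]≡n ρ≤) ⟩
        2 * ν * q + 4 * ν + B              ≡⟨ factor ν q B ⟩
        ν * (2 * q + 4) + B                ≤⟨ +-monoˡ-≤ B (*-monoʳ-≤ ν 2q+4≤m) ⟩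
        ν * m + B                          ≤⟨ +-mono-≤ (≤-reflexive (sym (total-const ν))) (equalWeight-total bs ps) ⟩
        total (λ S → ν) + total (equalWeight bs P) ≡⟨ total-+ (λ S → ν) (equalWeight bs P) ⟨
        total (λ S → ν + equalWeight bs P S) ≤⟨ total-mono ¬A _ _ (Bool.∧-conicalˡ _ _ e) ⟩
        total (λ S → rowWeight r S + disjointWeight as P S) ≡⟨ total-+ (rowWeight r) (disjointWeight as P) ⟩
        total (rowWeight r) + total (disjointWeight as P) ≤⟨ +-mono-≤ (rowWeight-total r) (disjointWeight-total as ps) ⟩
        ρ * q + D                          ∎)
      where
      open ≤-Reasoning
      ρ = sum (lookup r)
      D = disjointBound as P
      B = equalBound bs P
      ε = 2 * ν ∸ ρ
      e₂ = Bool.∧-conicalʳ (dominated A _ _) _ e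
      ρ≤ : ρ ≤ 2 * ν
      ρ≤ = ≤ᵇ-sound (Bool.∧-conicalˡ _ _ e₂)
      D< : D < B + 4 * ν + 41 * ε
      D< = ≤ᵇ-sound (Bool.∧-conicalʳ (ρ ≤ᵇ 2 * ν) _ e₂)
      rearrange : ∀ ρ ε q B ν → ρ * q + (B + 4 * ν + q * ε) ≡ (ρ + ε) * q + 4 * ν + B
      rearrange = solve-∀
      factor : ∀ ν q B → 2 * ν * q + 4 * ν + B ≡ ν * (2 * q + 4) + B
      factor = solve-∀

    -- The first domination gives ν m ≤ ρ q + D + 2x, whence q ≤ 4 + 2x; the second gives m + 2x ≤
    -- 3q, whence 4 + 2x ≤ q. So q would be even.
    even-sound : ∀ {P A} X ν r as r′ → All Occupied P → All-¬ A → check P A (even X ν r as r′) ≡ true → Empty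
    even-sound {P} {A} X ν r as r′ ps ¬A e = odd≢4+2* x (subst (λ q → parity q ≡ 1ℙ) (≤-antisym upper lower) odd)
      where
      open ≤-Reasoning
      ρ = sum (lookup r)
      D = disjointBound as P
      x = total (λ S → 𝟙 (equal S X))
      e₁ = Bool.∧-conicalˡ _ _ e
      e₂ = Bool.∧-conicalʳ (dominated A _ _ ∧ dominated A _ _) _ e
      e₃ = Bool.∧-conicalʳ (suc ρ ≤ᵇ 2 * ν) _ e₂
      suc-ρ≤ : suc ρ ≤ 2 * ν
      suc-ρ≤ = ≤ᵇ-sound (Bool.∧-conicalˡ _ _ e₂)
      D≤ : D ≤ 4 * ν + 4
      D≤ = ≤ᵇ-sound (Bool.∧-conicalˡ _ _ e₃)
      ρ′≤ : sum (lookup r′) ≤ 3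
      ρ′≤ = ≤ᵇ-sound (Bool.∧-conicalʳ (D ≤ᵇ 4 * ν + 4) _ e₃)
      regroup : ∀ ρ q ν x → ρ * q + (4 * ν + 4) + 2 * x ≡ (ρ * q + 4 * ν) + (4 + 2 * x)
      regroup = solve-∀
      expand : ∀ ν q → 2 * ν * q + 4 * ν ≡ ν * (2 * q + 4)
      expand = solve-∀
      swap : ∀ ρ q ν → (ρ * q + 4 * ν) + q ≡ suc ρ * q + 4 * ν
      swap = solve-∀
      upper : q ≤ 4 + 2 * x
      upper = +-cancelˡ-≤ (ρ * q + 4 * ν) q (4 + 2 * x) (begin
        (ρ * q + 4 * ν) + q                ≡⟨ swap ρ q ν ⟩
        suc ρ * q + 4 * ν                  ≤⟨ +-monoˡ-≤ (4 * ν) (*-monoˡ-≤ q suc-ρ≤) ⟩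
        2 * ν * q + 4 * ν                  ≡⟨ expand ν q ⟩
        ν * (2 * q + 4)                    ≤⟨ *-monoʳ-≤ ν 2q+4≤m ⟩
        ν * m                              ≡⟨ total-const ν ⟨
        total (λ S → ν)                    ≤⟨ total-mono ¬A _ _ (Bool.∧-conicalˡ _ _ e₁) ⟩
        total (λ S → rowWeight r S + disjointWeight as P S + 2 * 𝟙 (equal S X))
                                           ≡⟨ total-+ (λ S → rowWeight r S + disjointWeight as P S) (λ S → 2 * 𝟙 (equal S X)) ⟩
        total (λ S → rowWeight r S + disjointWeight as P S) + total (λ S → 2 * 𝟙 (equal S X))
                                           ≡⟨ cong₂ _+_ (total-+ (rowWeight r) (disjointWeight as P)) (total-scale 2 (λ S → 𝟙 (equal S X))) ⟩
        total (rowWeight r) + total (disjointWeight as P) + 2 * x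
                                           ≤⟨ +-monoˡ-≤ (2 * x) (+-mono-≤ (rowWeight-total r) (≤-trans (disjointWeight-total as ps) D≤)) ⟩
        ρ * q + (4 * ν + 4) + 2 * x        ≡⟨ regroup ρ q ν x ⟩
        (ρ * q + 4 * ν) + (4 + 2 * x)      ∎)
      collect : ∀ q x → 2 * q + (4 + 2 * x) ≡ 1 * (2 * q + 4) + 2 * x
      collect = solve-∀
      split : ∀ q → 3 * q ≡ 2 * q + q
      split = solve-∀
      lower : 4 + 2 * x ≤ q
      lower = +-cancelˡ-≤ (2 * q) (4 + 2 * x) q (begin
        2 * q + (4 + 2 * x)                ≡⟨ collect q x ⟩
        1 * (2 * q + 4) + 2 * x            ≤⟨ +-monoˡ-≤ (2 * x) (*-monoʳ-≤ 1 2q+4≤m) ⟩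
        1 * m + 2 * x                      ≡⟨ cong₂ _+_ (total-const 1) (total-scale 2 (λ S → 𝟙 (equal S X))) ⟨
        total (λ S → 1) + total (λ S → 2 * 𝟙 (equal S X)) ≡⟨ total-+ (λ S → 1) (λ S → 2 * 𝟙 (equal S X)) ⟨
        total (λ S → 1 + 2 * 𝟙 (equal S X)) ≤⟨ total-mono ¬A _ _ (Bool.∧-conicalʳ (dominated A _ _) _ e₁) ⟩
        total (rowWeight r′)               ≤⟨ rowWeight-total r′ ⟩
        sum (lookup r′) * q                ≤⟨ *-monoˡ-≤ q ρ′≤ ⟩
        3 * q                              ≡⟨ split q ⟩
        2 * q + q                          ∎)

    check-sound : ∀ {P A} t → All Occupied P → All-¬ A → check P A t ≡ true → Empty
    check-sound (farkas ν r as bs)  ps ¬A e = farkas-sound ν r as bs ps ¬A e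
    check-sound (even X ν r as r′)  ps ¬A e = even-sound X ν r as r′ ps ¬A e
    check-sound {P} {A} (branch S t u) ps ¬A e with occupied? S
    ... | yes o = check-sound t (o ∷ ps) ¬A (Bool.∧-conicalˡ _ _ e)
    ... | no ¬o = check-sound u ps (¬o ∷ ¬A) (Bool.∧-conicalʳ (check (S ∷ P) A t) _ e)

  -- Exclusion of row sets up to relabelling of rows

  Refuted : List RowSet → Set
  Refuted P = ∀ χ → All (Profile.Occupied q m χ) P → Empty

  relabel : Permutation′ 6 → Colouring q m → Colouring q m
  relabel π (f , proper , complete) = f′ , proper′ , complete′
    where
    G = K 6 □ K q
    f′ : Fin 6 × Fin q → Fin m
    f′ (i , j) = f (π ⟨$⟩ʳ i , j)
    proper′ : Proper G f′
    proper′ (inj₁ (i≢i′ , e)) = proper (inj₁ ((λ eq → i≢i′ (trans (sym (inverseˡ π)) (trans (cong (π ⟨$⟩ˡ_) eq) (inverseˡ π)))) , e))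
    proper′ (inj₂ (j≢j′ , e)) = proper (inj₂ (j≢j′ , cong (π ⟨$⟩ʳ_) e))
    complete′ : Complete G f′
    complete′ c≢c′ with complete c≢c′
    ... | (i , j) , (i′ , j′) , adj , e , e′ =
      (π ⟨$⟩ˡ i , j) , (π ⟨$⟩ˡ i′ , j′) , adj′ adj ,
      trans (cong (λ i → f (i , j)) (inverseʳ π)) e , trans (cong (λ i → f (i , j′)) (inverseʳ π)) e′
      where
      adj′ : (i ≢ i′ × j ≡ j′) ⊎ (j ≢ j′ × i ≡ i′) → (π ⟨$⟩ˡ i ≢ π ⟨$⟩ˡ i′ × j ≡ j′) ⊎ (j ≢ j′ × π ⟨$⟩ˡ i ≡ π ⟨$⟩ˡ i′)
      adj′ (inj₁ (i≢i′ , e)) = inj₁ ((λ eq → i≢i′ (trans (sym (inverseʳ π)) (trans (cong (π ⟨$⟩ʳ_) eq) (inverseʳ π)))) , e)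
      adj′ (inj₂ (j≢j′ , e)) = inj₂ (j≢j′ , cong (π ⟨$⟩ˡ_) e)

  relabel-occupied : ∀ π χ {S} → Profile.Occupied q m χ S → Profile.Occupied q m (relabel π χ) (permute π S)
  relabel-occupied π χ (c , refl) = c , tabulate-cong (λ i → sym (lookup∘tabulate (Profile.meets q m χ c) (π ⟨$⟩ʳ i)))

  -- Here it matters that `Refuted` quantifies over all colourings: the refutation of `P′` is
  -- applied to the relabelled one.
  relabelled : ∀ π {P P′} → map (permute π) P ≡ P′ → Refuted P′ → Refuted P
  relabelled π refl r χ ps = r (relabel π χ) (All.map⁺ (All.map (relabel-occupied π χ) ps))

  weaken : ∀ {S P} → Refuted (S ∷ []) → Refuted (S ∷ P)
  weaken r χ (o ∷ _) = r χ (o ∷ [])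

  Excluded : List RowSet → RowSet → Set
  Excluded P S = Refuted (S ∷ P)

  -- A member of `A` that occurred alongside `P` would contradict its own earlier exclusion, so the
  -- certificate may assume `A` absent.
  refute : ∀ {P A} t → All (Excluded P) A → check P A t ≡ true → Refuted P
  refute t excluded e χ ps = check-sound χ t ps (All.map (λ r o → r χ (o ∷ ps)) excluded) e

  ⊥-refuted : ∀ {P} → Refuted (⊥ ∷ P)
  ⊥-refuted χ (o ∷ _) = Profile.⊥-unoccupied q m χ 2≤m o

  singleton-refuted : ∀ i → Refuted (⁅ i ⁆ ∷ [])
  singleton-refuted i = refute (singleton-refutation i) (⊥-refuted ∷ []) (singleton-check i)

  thin-excluded : ∀ {P} → All (Excluded P) thin
  thin-excluded = ⊥-refuted ∷ All.map⁺ {f = ⁅_⁆} (All.universal (λ i → weaken (singleton-refuted i)) (allFin 6))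

  path-refuted : Refuted (pair 0F 2F ∷ pair 0F 1F ∷ [])
  path-refuted = refute path-refutation thin-excluded path-check

  -- send i x π maps i to x and agrees with π except at i and at the preimage of x.
  send : Fin 6 → Fin 6 → Permutation′ 6 → Permutation′ 6
  send i x π = transpose i (π ⟨$⟩ˡ x) ∘ₚ π

  -- The permutation sends 0, 1, 2 to `i`, `j`, `k`; taking preimages turns the two pairs through
  -- row `i` into 01 and 02.
  path-at : ∀ i j k → let π = send 2F k (send 1F j (send 0F i id)) in
            map (permute π) (pair i k ∷ pair i j ∷ []) ≡ pair 0F 2F ∷ pair 0F 1F ∷ [] →
            Refuted (pair i k ∷ pair i j ∷ [])
  path-at i j k eq = relabelled (send 2F k (send 1F j (send 0F i id))) eq path-refuted

  adjacent₀₁-excluded : All (Excluded (pair 0F 1F ∷ [])) adjacent₀₁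
  adjacent₀₁-excluded =
    path-at 0F 1F 2F refl ∷ path-at 0F 1F 3F refl ∷ path-at 0F 1F 4F refl ∷ path-at 0F 1F 5F refl ∷
    -- The shared row is now 1; `pair 1F 0F` computes to the same set as `pair 0F 1F`.
    path-at 1F 0F 2F refl ∷ path-at 1F 0F 3F refl ∷ path-at 1F 0F 4F refl ∷ path-at 1F 0F 5F refl ∷ []

  adjacent₂₃-excluded : All (Excluded (pair 2F 3F ∷ [])) adjacent₂₃
  adjacent₂₃-excluded =
    path-at 2F 3F 4F refl ∷ path-at 2F 3F 5F refl ∷ path-at 3F 2F 4F refl ∷ path-at 3F 2F 5F refl ∷ []

  two-couples-refuted : Refuted (pair 2F 3F ∷ pair 0F 1F ∷ [])
  two-couples-refuted = refute two-couples-refutation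
    (All.++⁺ thin-excluded (All.++⁺
      -- These exclusions involve only one of 01 and 23, so the other pair is dropped.
      (All.map (λ r χ → λ where (o ∷ _ ∷ o₀₁ ∷ []) → r χ (o ∷ o₀₁ ∷ [])) adjacent₀₁-excluded)
      (All.map (λ r χ → λ where (o ∷ o₂₃ ∷ _) → r χ (o ∷ o₂₃ ∷ [])) adjacent₂₃-excluded)))
    two-couples-check

  -- A second pair inside 2345 could be moved to 23 by a permutation fixing rows 0 and 1, so 01
  -- would be the only pair.
  couple-refuted : Refuted (pair 0F 1F ∷ [])
  couple-refuted = refute couple-refutation
    (All.++⁺ thin-excluded (All.++⁺ adjacent₀₁-excluded
      (at 2F 3F refl ∷ at 2F 4F refl ∷ at 2F 5F refl ∷ at 3F 4F refl ∷ at 3F 5F refl ∷ at 4F 5F refl ∷ [])))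
    couple-check
    where
    at : ∀ i j → let π = send 3F j (send 2F i id) in
         map (permute π) (pair i j ∷ pair 0F 1F ∷ []) ≡ pair 2F 3F ∷ pair 0F 1F ∷ [] →
         Refuted (pair i j ∷ pair 0F 1F ∷ [])
    at i j eq = relabelled (send 3F j (send 2F i id)) eq two-couples-refuted

  refuted : Refuted []
  refuted = refute pair-refutation
    (All.++⁺ thin-excluded
      (at 0F 1F refl ∷ at 0F 2F refl ∷ at 0F 3F refl ∷ at 0F 4F refl ∷ at 0F 5F refl ∷
       at 1F 2F refl ∷ at 1F 3F refl ∷ at 1F 4F refl ∷ at 1F 5F refl ∷
       at 2F 3F refl ∷ at 2F 4F refl ∷ at 2F 5F refl ∷
       at 3F 4F refl ∷ at 3F 5F refl ∷ at 4F 5F refl ∷ []))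
    pair-check
    where
    at : ∀ i j → let π = send 1F j (send 0F i id) in
         map (permute π) (pair i j ∷ []) ≡ pair 0F 1F ∷ [] → Refuted (pair i j ∷ [])
    at i j eq = relabelled (send 1F j (send 0F i id)) eq couple-refuted

upper-bound : ∀ q → 41 ≤ q → parity q ≡ 1ℙ → ∀ m → Colouring q m → m ≤ 2 * q + 3
upper-bound q 41≤q odd m χ with m ≤? 2 * q + 3
... | yes m≤ = m≤
... | no  m≰ = ⊥-elim (Overfull.refuted {q} {m} 41≤q odd (≤-trans (≤-reflexive (+-suc (2 * q) 3)) (≰⇒> m≰)) χ [])

-- Cyclic shifts

next prev : Fin (suc n) → Fin (suc n)
next i with view i
... | ‵fromℕ     = zero
... | ‵inject₁ j = suc j
prev zero    = fromℕ _
prev (suc i) = inject₁ i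

next-prev : (i : Fin (suc n)) → next (prev i) ≡ i
next-prev {n} zero rewrite view-fromℕ n = refl
next-prev (suc i) rewrite view-inject₁ i = refl

prev-next : (i : Fin (suc n)) → prev (next i) ≡ i
prev-next i with view i
... | ‵fromℕ     = refl
... | ‵inject₁ j = refl

suc≢inject₁ : (i : Fin n) → suc i ≢ inject₁ i
suc≢inject₁ (suc i) eq = suc≢inject₁ i (suc-injective eq)

prev≢id : (i : Fin (2 + n)) → prev i ≢ i
prev≢id zero    = λ ()
prev≢id (suc i) = ≢-sym (suc≢inject₁ i)

shift unshift : Bool → Fin (suc n) → Fin (suc n)
shift false i = i
shift true  i = next i
unshift false i = i
unshift true  i = prev i

shift-unshift : ∀ b (i : Fin (suc n)) → shift b (unshift b i) ≡ i
shift-unshift false i = refl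
shift-unshift true  i = next-prev i

shift-injective : ∀ b {i j : Fin (suc n)} → shift b i ≡ shift b j → i ≡ j
shift-injective false eq = eq
shift-injective true {i} {j} eq = trans (sym (prev-next i)) (trans (cong prev eq) (prev-next j))

next≢id : (i : Fin (2 + n)) → next i ≢ i
next≢id i eq = prev≢id i (trans (cong prev (sym eq)) (prev-next i))

-- A shift by 0 and a shift by 1 never agree, as there are at least two indices.
shift-apart : ∀ {b b′} (i : Fin (2 + n)) → shift b i ≡ shift b′ i → b ≡ b′
shift-apart {b = false} {false} i eq = refl
shift-apart {b = false} {true}  i eq = contradiction (sym eq) (next≢id i)
shift-apart {b = true}  {false} i eq = contradiction eq (next≢id i)
shift-apart {b = true}  {true}  i eq = refl

-- The colouring with 2q + 3 colours

couple : Fin 6 → Fin 3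
couple 0F = 0F
couple 1F = 0F
couple 2F = 1F
couple 3F = 1F
couple 4F = 2F
couple 5F = 2F

second : Fin 6 → Bool
second 0F = false
second 1F = true
second 2F = false
second 3F = true
second 4F = false
second 5F = true

-- The classes 0F, 1F, 2F, 3F consist of 3-colours with row sets 024, 035,
-- 125, 134; the second argument selects the half of the columns.
class : Fin 6 → Fin 2 → Fin 4
class 0F 0F = 0F
class 0F 1F = 1F
class 1F 0F = 2F
class 1F 1F = 3F
class 2F 0F = 2F
class 2F 1F = 0F
class 3F 0F = 3F
class 3F 1F = 1F
class 4F 0F = 0F
class 4F 1F = 3F
class 5F 0F = 1F
class 5F 1F = 2F

-- A class met twice by a half of the columns is shifted in just one of the two
-- rows, so that its colours do not repeat in a column.
shifted : Fin 6 → Fin 2 → Bool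
shifted 2F 0F = true
shifted 3F 1F = true
shifted 4F 0F = true
shifted 4F 1F = true
shifted _  _  = false

Column Colour : ℕ → Set
Column n = Fin 3 ⊎ (Fin 2 × Fin n)
Colour n = (Fin 3 × Fin 3) ⊎ (Fin 4 × Fin n)

-- Each row runs through all three 2-colours of its couple and all 3-colours of its two classes. The
-- second row of a couple is rotated by one step so that no 2-colour repeats in a column.
entry : Fin 6 → Column (suc n) → Colour (suc n)
entry i (inj₁ s)       = inj₁ (couple i , shift (second i) s)
entry i (inj₂ (h , j)) = inj₂ (class i h , shift (shifted i h) j)

-- Properness and completeness of the colouring

class-injective : ∀ i h h′ → class i h ≡ class i h′ → h ≡ h′
class-injective = from-yes (all? λ i → all? λ h → all? λ h′ → (class i h ≟ class i h′) →-dec (h ≟ h′))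

class-shifted-injective : ∀ i i′ h → class i h ≡ class i′ h → shifted i h ≡ shifted i′ h → i ≡ i′
class-shifted-injective = from-yes (all? λ i → all? λ i′ → all? λ h →
  (class i h ≟ class i′ h) →-dec (shifted i h Bool.≟ shifted i′ h) →-dec (i ≟ i′))

couple-second-injective : ∀ i i′ → couple i ≡ couple i′ → second i ≡ second i′ → i ≡ i′
couple-second-injective = from-yes (all? λ i → all? λ i′ →
  (couple i ≟ couple i′) →-dec (second i Bool.≟ second i′) →-dec (i ≟ i′))

entry-injectiveʳ : ∀ i {j j′ : Column (suc n)} → entry i j ≡ entry i j′ → j ≡ j′
entry-injectiveʳ i {inj₁ s} {inj₁ s′} eq =
  cong inj₁ (shift-injective (second i) (proj₂ (,-injective (inj₁-injective eq))))
entry-injectiveʳ i {inj₂ (h , j)} {inj₂ (h′ , j′)} eq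
  with class-injective i h h′ (proj₁ (,-injective (inj₂-injective eq)))
... | refl = cong (λ j → inj₂ (h , j)) (shift-injective (shifted i h) (proj₂ (,-injective (inj₂-injective eq))))

entry-injectiveˡ : ∀ {i i′} (j : Column (2 + n)) → entry i j ≡ entry i′ j → i ≡ i′
entry-injectiveˡ {i = i} {i′} (inj₁ s) eq =
  let eq₁ , eq₂ = ,-injective (inj₁-injective eq) in
  couple-second-injective i i′ eq₁ (shift-apart s eq₂)
entry-injectiveˡ {i = i} {i′} (inj₂ (h , j)) eq =
  let eq₁ , eq₂ = ,-injective (inj₂-injective eq) in
  class-shifted-injective i i′ h eq₁ (shift-apart j eq₂)

-- The four triples are transversals of one parity class: two different ones disagree on exactly two
-- couples and share a row in the third.
class-class : ∀ t t′ → ∃[ i ] (∃[ h ] class i h ≡ t) × (∃[ h ] class i h ≡ t′)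
class-class = from-yes (all? λ t → all? λ t′ → any? λ i →
  any? (λ h → class i h ≟ t) ×-dec any? (λ h → class i h ≟ t′))

couple-class : ∀ p t → ∃[ i ] couple i ≡ p × (∃[ h ] class i h ≡ t)
couple-class = from-yes (all? λ p → all? λ t → any? λ i →
  (couple i ≟ p) ×-dec any? (λ h → class i h ≟ t))

row : ∀ p b → ∃[ i ] couple i ≡ p × second i ≡ b
row p false = from-yes (all? λ p → any? λ i → (couple i ≟ p) ×-dec (second i Bool.≟ false)) p
row p true  = from-yes (all? λ p → any? λ i → (couple i ≟ p) ×-dec (second i Bool.≟ true)) p

-- Any two 2-subsets {s, prev s} of the three full columns meet.
shared-column : ∀ (s s′ : Fin 3) → ∃[ j ] (∃[ b ] shift b j ≡ s) × (∃[ b ] shift b j ≡ s′)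
shared-column 0F 0F = 0F , (false , refl) , (false , refl)
shared-column 0F 1F = 0F , (false , refl) , (true  , refl)
shared-column 0F 2F = 2F , (true  , refl) , (false , refl)
shared-column 1F 0F = 0F , (true  , refl) , (false , refl)
shared-column 1F 1F = 1F , (false , refl) , (false , refl)
shared-column 1F 2F = 1F , (false , refl) , (true  , refl)
shared-column 2F 0F = 2F , (false , refl) , (true  , refl)
shared-column 2F 1F = 1F , (true  , refl) , (false , refl)
shared-column 2F 2F = 2F , (false , refl) , (false , refl)

couple-position : ∀ {i p} → couple i ≡ p → ∀ s → ∃[ j ] entry {n} i j ≡ inj₁ (p , s)
couple-position {i = i} refl s = inj₁ (unshift (second i) s) , cong (λ s → inj₁ (couple i , s)) (shift-unshift (second i) s)

class-position : ∀ {i h t} → class i h ≡ t → ∀ a → ∃[ j ] entry {n} i j ≡ inj₂ (t , a)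
class-position {i = i} {h} refl a =
  inj₂ (h , unshift (shifted i h) a) , cong (λ a → inj₂ (class i h , a)) (shift-unshift (shifted i h) a)

Line : (c c′ : Colour (suc n)) → Set
Line {n} c c′ =
  (∃[ i ] ∃[ j ] ∃[ j′ ] entry {n} i j ≡ c × entry i j′ ≡ c′) ⊎
  (∃[ j ] ∃[ i ] ∃[ i′ ] entry {n} i j ≡ c × entry i′ j ≡ c′)

-- A row set of a 3-colour meets that of every other colour, and a common row contains both colours.
-- Two 2-colours may have no common row and are found in a common column instead.
line : (c c′ : Colour (suc n)) → Line c c′
line (inj₂ (t , a)) (inj₂ (t′ , a′)) =
  let i , (_ , e) , (_ , e′) = class-class t t′
      j  , f  = class-position e a
      j′ , f′ = class-position e′ a′
  in inj₁ (i , j , j′ , f , f′)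
line (inj₁ (p , s)) (inj₂ (t , a)) =
  let i , e , (_ , e′) = couple-class p t
      j  , f  = couple-position e s
      j′ , f′ = class-position e′ a
  in inj₁ (i , j , j′ , f , f′)
line (inj₂ (t , a)) (inj₁ (p , s)) =
  let i , e , (_ , e′) = couple-class p t
      j  , f  = couple-position e s
      j′ , f′ = class-position e′ a
  in inj₁ (i , j′ , j , f′ , f)
line (inj₁ (p , s)) (inj₁ (p′ , s′)) =
  let j , (b , e) , (b′ , e′) = shared-column s s′
      i  , f  , g  = row p b
      i′ , f′ , g′ = row p′ b′
  in inj₂ (inj₁ j , i , i′ ,
       cong inj₁ (cong₂ _,_ f  (trans (cong (λ b → shift b j) g) e)) ,
       cong inj₁ (cong₂ _,_ f′ (trans (cong (λ b → shift b j) g′) e′)))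

-- Transfer to `Fin` and the lower bound

column↔ : ∀ n → Column n ↔ Fin (3 + 2 * n)
column↔ n = ↔-sym +↔⊎ ↔-∘ (↔-id _ ⊎-↔ ↔-sym *↔×)

colour↔ : ∀ n → Colour n ↔ Fin (9 + 4 * n)
colour↔ n = ↔-sym +↔⊎ ↔-∘ (↔-sym *↔× ⊎-↔ ↔-sym *↔×)

colouring : ∀ n → HasProperCompleteColouring (K 6 □ K (3 + 2 * (2 + n))) (9 + 4 * (2 + n))
colouring n = f , proper , complete
  where
  open Inverse (column↔ (2 + n)) using () renaming
    (from to column; to to column⁻¹; strictlyInverseˡ to column⁻¹-column; strictlyInverseʳ to column-column⁻¹)
  open Inverse (colour↔ (2 + n)) using () renaming
    (to to colour; from to colour⁻¹; strictlyInverseˡ to colour-colour⁻¹; strictlyInverseʳ to colour⁻¹-colour)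

  G = K 6 □ K (3 + 2 * (2 + n))

  f : Fin 6 × Fin (3 + 2 * (2 + n)) → Fin (9 + 4 * (2 + n))
  f (i , j) = colour (entry i (column j))

  colour-injective : ∀ {c c′} → colour c ≡ colour c′ → c ≡ c′
  colour-injective eq = trans (sym (colour⁻¹-colour _)) (trans (cong colour⁻¹ eq) (colour⁻¹-colour _))

  column-injective : ∀ {j j′} → column j ≡ column j′ → j ≡ j′
  column-injective eq = trans (sym (column⁻¹-column _)) (trans (cong column⁻¹ eq) (column⁻¹-column _))

  proper : Proper G f
  proper {_ , j} (inj₁ (i≢i′ , refl)) eq = i≢i′ (entry-injectiveˡ (column j) (colour-injective eq))
  proper {i , _} (inj₂ (j≢j′ , refl)) eq = j≢j′ (column-injective (entry-injectiveʳ i (colour-injective eq)))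

  f-at : ∀ {i j c} → entry i j ≡ colour⁻¹ c → f (i , column⁻¹ j) ≡ c
  f-at {i} {j} e = trans (cong colour (trans (cong (entry i) (column-column⁻¹ j)) e)) (colour-colour⁻¹ _)

  complete : Complete G f
  complete {c} {c′} c≢c′ with line (colour⁻¹ c) (colour⁻¹ c′)
  -- `Line` does not keep the two cells apart; here the distinct colours do.
  ... | inj₁ (i , j , j′ , e , e′) = (i , column⁻¹ j) , (i , column⁻¹ j′) ,
        inj₂ ((λ eq → c≢c′ (trans (sym (f-at e)) (trans (cong (λ j → f (i , j)) eq) (f-at e′)))) , refl) ,
        f-at e , f-at e′
  ... | inj₂ (j , i , i′ , e , e′) = (i , column⁻¹ j) , (i′ , column⁻¹ j) ,
        inj₁ ((λ eq → c≢c′ (trans (sym (f-at e)) (trans (cong (λ i → f (i , column⁻¹ j)) eq) (f-at e′)))) , refl) ,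
        f-at e , f-at e′

-- The q - 3 columns split into two halves of size 2 + n, as `shift-apart` asks for at least two
-- indices.
odd≥7 : ∀ d → parity (7 + d) ≡ 1ℙ → ∃[ n ] 7 + d ≡ 3 + 2 * (2 + n)
odd≥7 zero          _   = 0 , refl
odd≥7 (suc (suc d)) odd with odd≥7 d odd
... | n , eq = suc n , trans (cong (2 +_) eq) (step n)
  where
  step : ∀ n → 2 + (3 + 2 * (2 + n)) ≡ 3 + 2 * (2 + suc n)
  step = solve-∀

lower-bound : ∀ q → 7 ≤ q → parity q ≡ 1ℙ → HasProperCompleteColouring (K 6 □ K q) (2 * q + 3)
lower-bound q 7≤q odd with m≤n⇒∃[o]m+o≡n 7≤q
... | d , refl with odd≥7 d odd
... | n , eq = subst (λ q → HasProperCompleteColouring (K 6 □ K q) (2 * q + 3)) (sym eq)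
    (subst (HasProperCompleteColouring (K 6 □ K (3 + 2 * (2 + n)))) (count n) (colouring n))
  where
  -- Nine 2-colours and four classes of (q - 3)/2 colours: 9 + 2(q - 3) = 2q + 3.
  count : ∀ n → 9 + 4 * (2 + n) ≡ 2 * (3 + 2 * (2 + n)) + 3
  count = solve-∀

theorem2 : (q : ℕ) → 41 ≤ q → parity q ≡ 1ℙ → IsAchromaticNumber (K 6 □ K q) (2 * q + 3)
theorem2 q 41≤q odd = lower-bound q (≤-trans (m≤m+n 7 34) 41≤q) odd , upper-bound q 41≤q odd
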